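{- The $\mathcal{B}\Sigma_1$-covering problem is decidable.
   Context: $A$ is a fixed finite alphabet; languages are subsets of $A^*$. **The class $\mathcal{B}\Sigma_1$.** A word is viewed as a (possibly empty) linearly ordered sequence of positions labeled over $A$; first-order sentences use unary predicates $P_a$ ($a\in A$, "the position carries $a$") and the strict order $<$. A $\Sigma_1$ sentence is one whose prenex normal form has only existential quantifiers (a single block of existential quantifiers, or no quantifier), and a $\mathcal{B}\Sigma_1$ sentence is a Boolean combination of $\Sigma_1$ sentences. $\mathcal{B}\Sigma_1$ also denotes the class of languages over $A$ definable by such sentences. **Covering.** For a class $\mathcal{C}$ and a language $L$, a $\mathcal{C}$-cover of $L$ is a finite set $\mathbf{K}$ of languages belonging to $\mathcal{C}$ with $L\subseteq\bigcup_{K\in\mathbf{K}}K$. A set $\mathbf{K}$ of languages is separating for a finite multiset of languages $\mathbf{L}$ if for every $K\in\mathbf{K}$ there exists $L'\in\mathbf{L}$ with $K\cap L'=\emptyset$. The pair $(L,\mathbf{L})$ is $\mathcal{C}$-coverable if there is a $\mathcal{C}$-cover of $L$ that is separating for $\mathbf{L}$. The $\mathcal{C}$-covering problem: given as input a regular language $L$ and a finite multiset $\mathbf{L}$ of regular languages (given by nondeterministic finite automata or by morphisms into finite monoids), decide whether $(L,\mathbf{L})$ is $\mathcal{C}$-coverable. -}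

module Defs where

open import Algebra.Bundles.Raw using (RawMonoid)
open import Algebra.Core using (Op₂)
open import Algebra.Morphism.Structures using (module MonoidMorphisms)
open import Algebra.Structures using (IsMonoid)
open import Data.Empty using (⊥)
open import Data.Fin.Base using (Fin; _<_)
open import Data.Fin.Subset using (Subset) renaming (_∈_ to _∈ˢ_)
open import Data.List.Base
  using (List; []; _∷_; length; lookup; map; ++-[]-rawMonoid)
open import Data.List.Relation.Unary.All using (All)
open import Data.List.Relation.Unary.Any using (Any)
open import Data.Nat.Base using (ℕ; suc)
open import Data.Product.Base using (_×_; _,_; ∃-syntax)
open import Data.Sum.Base using (_⊎_)
open import Data.Unit.Base using (⊤)
open import Data.Vec.Functional as Vector using (Vector)
open import Level using (Level; 0ℓ; _⊔_) renaming (suc to lsuc)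
open import Relation.Binary.PropositionalEquality.Core using (_≡_)
open import Relation.Nullary.Negation.Core using (¬_)
open import Relation.Unary using (Pred; _∈_; _∩_; _≐_; Empty)

private
  variable
    ℓ : Level
    k n : ℕ

-- The alphabet is Fin k.

Word : ℕ → Set
Word k = List (Fin k)

Language : ℕ → Set₁
Language k = Pred (Word k) 0ℓ

infix  9 _<′_
infixr 7 _∧′_
infixr 6 _∨′_

-- Formulas with n free variables (de Bruijn indices; the variable bound by
-- the innermost quantifier is zero).

data Formula (k : ℕ) : ℕ → Set where
  ⊤′ ⊥′     : Formula k n
  P         : Fin k → Fin n → Formula k n
  _<′_      : Fin n → Fin n → Formula k n
  ¬′_       : Formula k n → Formula k n
  _∧′_ _∨′_ : Formula k n → Formula k n → Formula k n
  ∃′_ ∀′_   : Formula k (suc n) → Formula k n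

Sentence : ℕ → Set
Sentence k = Formula k 0

-- The positions of w are Fin (length w); there are none when w is empty.

Sat : (w : Word k) → Vector (Fin (length w)) n → Formula k n → Set
Sat w ρ ⊤′       = ⊤
Sat w ρ ⊥′       = ⊥
Sat w ρ (P a x)  = lookup w (ρ x) ≡ a
Sat w ρ (x <′ y) = ρ x < ρ y
Sat w ρ (¬′ φ)   = ¬ Sat w ρ φ
Sat w ρ (φ ∧′ ψ) = Sat w ρ φ × Sat w ρ ψ
Sat w ρ (φ ∨′ ψ) = Sat w ρ φ ⊎ Sat w ρ ψ
Sat w ρ (∃′ φ)   = ∃[ i ] Sat w (i Vector.∷ ρ) φ
Sat w ρ (∀′ φ)   = ∀ i → Sat w (i Vector.∷ ρ) φ

Defined : Sentence k → Language k
Defined φ w = Sat w Vector.[] φ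

data QuantifierFree {k} : Formula k n → Set where
  ⊤-qf : QuantifierFree {n = n} ⊤′
  ⊥-qf : QuantifierFree {n = n} ⊥′
  P-qf : ∀ a (x : Fin n) → QuantifierFree (P a x)
  <-qf : (x y : Fin n) → QuantifierFree (x <′ y)
  ¬-qf : {φ : Formula k n} → QuantifierFree φ → QuantifierFree (¬′ φ)
  ∧-qf : {φ ψ : Formula k n} →
         QuantifierFree φ → QuantifierFree ψ → QuantifierFree (φ ∧′ ψ)
  ∨-qf : {φ ψ : Formula k n} →
         QuantifierFree φ → QuantifierFree ψ → QuantifierFree (φ ∨′ ψ)

-- Formulas in prenex normal form whose prefix is a (possibly empty) block of
-- existential quantifiers.  Sentences that merely have such a prenex normal form
-- define no further languages.

data IsΣ₁ {k} : Formula k n → Set where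
  matrix : {φ : Formula k n} → QuantifierFree φ → IsΣ₁ φ
  exists : {φ : Formula k (suc n)} → IsΣ₁ φ → IsΣ₁ (∃′ φ)

data IsBΣ₁ {k} : Sentence k → Set where
  Σ₁-base : {φ : Sentence k} → IsΣ₁ φ → IsBΣ₁ φ
  ¬-bool  : {φ : Sentence k} → IsBΣ₁ φ → IsBΣ₁ (¬′ φ)
  ∧-bool  : {φ ψ : Sentence k} → IsBΣ₁ φ → IsBΣ₁ ψ → IsBΣ₁ (φ ∧′ ψ)
  ∨-bool  : {φ ψ : Sentence k} → IsBΣ₁ φ → IsBΣ₁ ψ → IsBΣ₁ (φ ∨′ ψ)

LanguageClass : ℕ → (ℓ : Level) → Set (lsuc 0ℓ ⊔ lsuc ℓ)
LanguageClass k ℓ = Pred (Language k) ℓ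

BΣ₁ : ∀ k → LanguageClass k 0ℓ
BΣ₁ k K = ∃[ φ ] IsBΣ₁ φ × K ≐ Defined {k} φ

-- Finite sets and finite multisets of languages are both listed by a List:
-- none of the notions below depends on order or multiplicity.

IsCover : LanguageClass k ℓ → Language k → List (Language k) → Set (lsuc 0ℓ ⊔ ℓ)
IsCover 𝒞 L 𝐊 = All 𝒞 𝐊 × (∀ {w} → w ∈ L → Any (w ∈_) 𝐊)

Separating : List (Language k) → List (Language k) → Set₁
Separating 𝐊 𝐋 = All (λ K → Any (λ L′ → Empty (K ∩ L′)) 𝐋) 𝐊

Coverable : LanguageClass k ℓ → Language k → List (Language k) → Set (lsuc 0ℓ ⊔ ℓ)
Coverable 𝒞 L 𝐋 = ∃[ 𝐊 ] IsCover 𝒞 L 𝐊 × Separating 𝐊 𝐋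

record NFA (k : ℕ) : Set where
  field
    states  : ℕ
    initial : Subset states
    final   : Subset states
    δ       : Fin states → Fin k → Subset states

  AcceptsFrom : Fin states → Language k
  AcceptsFrom q []      = q ∈ˢ final
  AcceptsFrom q (a ∷ w) = ∃[ q′ ] (q′ ∈ˢ δ q a) × AcceptsFrom q′ w

  Accepts : Language k
  Accepts w = ∃[ q ] (q ∈ˢ initial) × AcceptsFrom q w

-- A morphism from the free monoid into a finite monoid, with an accepting
-- set; the language is the preimage of that set.

record MonoidRecognizer (k : ℕ) : Set where
  field
    size     : ℕ
    _∙_      : Op₂ (Fin size)
    ε        : Fin size
    isMonoid : IsMonoid _≡_ _∙_ ε

  rawMonoid : RawMonoid 0ℓ 0ℓ
  rawMonoid = record { Carrier = Fin size ; _≈_ = _≡_ ; _∙_ = _∙_ ; ε = ε }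

  open MonoidMorphisms (++-[]-rawMonoid (Fin k)) rawMonoid
    using (IsMonoidHomomorphism)

  field
    α         : Word k → Fin size
    α-homo    : IsMonoidHomomorphism α
    accepting : Subset size

  Recognized : Language k
  Recognized w = α w ∈ˢ accepting

data RegularInput (k : ℕ) : Set where
  automaton : NFA k → RegularInput k
  morphism  : MonoidRecognizer k → RegularInput k

⟦_⟧ : RegularInput k → Language k
⟦ automaton 𝒜 ⟧ = NFA.Accepts 𝒜
⟦ morphism ℳ ⟧  = MonoidRecognizer.Recognized ℳ

-- The set of positive instances of the 𝒞-covering problem.  In axiom-free
-- Agda, a term of type Relation.Unary.Decidable (CoveringProblem 𝒞) is an
-- algorithm that decides it.

CoveringProblem : LanguageClass k ℓ →
                  Pred (RegularInput k × List (RegularInput k)) (lsuc 0ℓ ⊔ ℓ)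
CoveringProblem 𝒞 (L , 𝐋) = Coverable 𝒞 ⟦ L ⟧ (map ⟦_⟧ 𝐋)

{-# OPTIONS --safe #-}

-- Describe a word by a template: a sequence of letters and blocks B, where a
-- block stands for a factor over the alphabet B that contains B ^ N as a
-- subword.  For fixed N, finitely many templates T describe all words, and the
-- words w of T, namely those with unfold N T ⊆ w in the ideal generated by T,
-- form a piecewise testable language.  If T is reduced (no symbol can be
-- absorbed by a neighbouring block) and N exceeds the number of states, then an
-- accepted word of T factors along T, and the pigeonhole principle finds in each
-- block a state with a loop whose alphabet is that block.  Conversely, pumping
-- these loops yields accepted words of T for every N, and any two words of T for
-- N have the same subwords of length at most N.  Hence an instance is coverable
-- if and only if none of the finitely many templates labels accepting paths in
-- all the automata at once, which is checked by computing reachability.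
module Submission where

open import Defs
open import Algebra.Morphism.Structures using (module MonoidMorphisms)
open import Algebra.Structures using (IsMonoid)
open import Data.Fin.Base using (Fin; zero; suc; toℕ; _<_)
import Data.Fin.Properties as Fin
open import Data.Fin.Subset using (⁅_⁆) renaming (_∈_ to _∈ˢ_)
open import Data.Fin.Subset.Properties using (x∈⁅x⁆; x∈⁅y⁆⇒x≡y) renaming (_∈?_ to _∈ˢ?_)
open import Data.List.Base
  using (List; []; _∷_; [_]; _++_; length; lookup; drop; map; concat; concatMap; replicate;
         filter; allFin; cartesianProductWith)
import Data.List.Properties as List
open import Data.List.Membership.DecPropositional as DecMembership using ()
open import Data.List.Membership.Propositional using (_∈_; _∉_; find; lose)
open import Data.List.Membership.Propositional.Properties
  using (∈-map⁺; ∈-map⁻; ∈-++⁺ˡ; ∈-++⁺ʳ; ∈-filter⁺; ∈-filter⁻; ∈-allFin; ∈-∃++;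
         ∈-cartesianProductWith⁺)
open import Data.List.Relation.Binary.Sublist.Propositional
  using (_⊆_; []; _∷_; _∷ʳ_; ⊆-refl; ⊆-trans; minimum; from∈)
open import Data.List.Relation.Binary.Sublist.Propositional.Properties
  using (++⁺; ++⁺ˡ; ++⁺ʳ; ∷⁻; drop⁺; drop-⊆; Any-resp-⊆)
open import Data.List.Relation.Unary.All as All using (All; []; _∷_)
import Data.List.Relation.Unary.All.Properties as All
open import Data.List.Relation.Unary.Any as Any using (Any; here; there)
import Data.List.Relation.Unary.Any.Properties as Any
open import Data.Nat.Base using (ℕ; zero; suc; _⊔_; _≤_; z≤n; s≤s; s≤s⁻¹; s<s; s<s⁻¹)
import Data.Nat.Properties as ℕ
open import Data.List.Extrema ℕ.≤-totalOrder using (max; xs≤max)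
open import Data.Product.Base using (∃; ∃-syntax; ∃₂; Σ-syntax; _×_; _,_; proj₁; proj₂)
open import Data.Sum.Base as Sum using (_⊎_; inj₁; inj₂)
open import Data.Unit.Base using (⊤; tt)
open import Data.Vec.Functional as Vector using (Vector)
open import Function.Base using (_∘_; id)
open import Level using (0ℓ)
open import Relation.Binary.Construct.Closure.ReflexiveTransitive
  using (Star; _◅_; _◅◅_) renaming (ε to stop)
open import Relation.Binary.Core using (Rel)
import Relation.Binary.Definitions as Binary
open import Relation.Binary.PropositionalEquality
  using (_≡_; refl; sym; trans; cong; subst; subst₂; _≗_)
open import Relation.Nullary.Decidable
  using (Dec; yes; no; map′; ¬?; decidable-stable; _×-dec_; _⊎-dec_)
open import Relation.Nullary.Negation using (¬_; contradiction)
open import Relation.Unary using (Decidable; _≐_)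

private
  variable
    k n N : ℕ
    a b : Fin k
    u v w x B : Word k
    φ : Formula k n

-- Templates and ideals

infix 4 _∈?_ _over_ _over?_ _∈↓_ _∈⟨_⟩_ _∈↓?_ _⊑_

_∈?_ : (a : Fin k) (w : Word k) → Dec (a ∈ w)
_∈?_ = DecMembership._∈?_ Fin._≟_

_over_ : Word k → Word k → Set
w over B = All (_∈ B) w

_over?_ : (w B : Word k) → Dec (w over B)
w over? B = All.all? (_∈? B) w

infixr 8 _^_

_^_ : Word k → ℕ → Word k
B ^ N = concat (replicate N B)

data Symbol (k : ℕ) : Set where
  letter : Fin k → Symbol k
  block  : Word k → Symbol k

Template : ℕ → Set
Template k = List (Symbol k)

private
  variable
    t     : Symbol k
    T T′  : Template k

expand : ℕ → Symbol k → Word k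
expand N (letter a) = [ a ]
expand N (block B)  = B ^ N

unfold : ℕ → Template k → Word k
unfold N = concatMap (expand N)

-- w ∈↓ T: w is in the product of the languages {ε , a} for the letters a and B*
-- for the blocks B of T.
data _∈↓_ {k} : Word k → Template k → Set where
  done : [] ∈↓ []
  omit : w ∈↓ T → w ∈↓ letter a ∷ T
  take : w ∈↓ T → a ∷ w ∈↓ letter a ∷ T
  exit : w ∈↓ T → w ∈↓ block B ∷ T
  stay : a ∈ B → w ∈↓ block B ∷ T → a ∷ w ∈↓ block B ∷ T

record _∈⟨_⟩_ {k} (w : Word k) (N : ℕ) (T : Template k) : Set where
  constructor _,_
  field
    below : w ∈↓ T
    above : unfold N T ⊆ w

skip : ∀ t → w ∈↓ T → w ∈↓ t ∷ T
skip (letter _) = omit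
skip (block _)  = exit

empty-∈↓ : (T : Template k) → [] ∈↓ T
empty-∈↓ []      = done
empty-∈↓ (t ∷ T) = skip t (empty-∈↓ T)

∈↓-down : u ⊆ w → w ∈↓ T → u ∈↓ T
∈↓-down []         done       = done
∈↓-down e          (omit d)   = omit (∈↓-down e d)
∈↓-down (_ ∷ʳ e)   (take d)   = omit (∈↓-down e d)
∈↓-down (refl ∷ e) (take d)   = take (∈↓-down e d)
∈↓-down e          (exit d)   = exit (∈↓-down e d)
∈↓-down (_ ∷ʳ e)   (stay m d) = ∈↓-down e d
∈↓-down (refl ∷ e) (stay m d) = stay m (∈↓-down e d)

∈↓-++ : u ∈↓ T → v ∈↓ T′ → u ++ v ∈↓ T ++ T′
∈↓-++ done       e = e
∈↓-++ (omit d)   e = omit (∈↓-++ d e)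
∈↓-++ (take d)   e = take (∈↓-++ d e)
∈↓-++ (exit d)   e = exit (∈↓-++ d e)
∈↓-++ (stay m d) e = stay m (∈↓-++ d e)

∈↓-over : u over B → w ∈↓ block B ∷ T → u ++ w ∈↓ block B ∷ T
∈↓-over []       d = d
∈↓-over (m ∷ ms) d = stay m (∈↓-over ms d)

∈↓-block⁻ : w ∈↓ block B ∷ T → ∃₂ λ u v → w ≡ u ++ v × u over B × v ∈↓ T
∈↓-block⁻ (exit d) = [] , _ , refl , [] , d
∈↓-block⁻ (stay m d) with u , v , refl , ms , d′ ← ∈↓-block⁻ d =
  _ ∷ u , v , refl , m ∷ ms , d′

_∈↓?_ : (w : Word k) (T : Template k) → Dec (w ∈↓ T)
[]      ∈↓? T  = yes (empty-∈↓ T)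
(a ∷ w) ∈↓? [] = no λ ()
(a ∷ w) ∈↓? (letter b ∷ T) with (a ∷ w) ∈↓? T
... | yes d = yes (omit d)
... | no ¬d with a Fin.≟ b | w ∈↓? T
...   | yes refl | yes d  = yes (take d)
...   | no a≢b   | _      = no λ where
        (omit d) → ¬d d
        (take _) → a≢b refl
...   | yes refl | no ¬d′ = no λ where
        (omit d) → ¬d d
        (take d) → ¬d′ d
(a ∷ w) ∈↓? (block B ∷ T) with (a ∷ w) ∈↓? T
... | yes d = yes (exit d)
... | no ¬d with a ∈? B | w ∈↓? (block B ∷ T)
...   | yes m | yes d  = yes (stay m d)
...   | no ¬m | _      = no λ where
        (exit d)   → ¬d d
        (stay m _) → ¬m m
...   | yes _ | no ¬d′ = no λ where
        (exit d)   → ¬d d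
        (stay _ d) → ¬d′ d

power-⊆ : (B : Word k) → ∀ N → B ^ N ⊆ B ^ suc N
power-⊆ B N = ++⁺ˡ B ⊆-refl

over-⊆-power : length x ≤ N → x over B → x ⊆ B ^ N
over-⊆-power {N = N}     _       []       = minimum _
over-⊆-power {N = suc N} (s≤s l) (m ∷ ms) = ++⁺ (from∈ m) (over-⊆-power l ms)

-- The factor of `x` inside a block has at most `N` letters, and each of them can be sent to a copy
-- of its own in `B ^ N`.
short-⊆-unfold : ∀ T → length x ≤ N → x ∈↓ T → x ⊆ unfold N T
short-⊆-unfold []             l done     = []
short-⊆-unfold (letter a ∷ T) l (omit d) = a ∷ʳ short-⊆-unfold T l d
short-⊆-unfold (letter a ∷ T) l (take d) = refl ∷ short-⊆-unfold T (ℕ.<⇒≤ l) d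
short-⊆-unfold (block B ∷ T)  l d with u , v , refl , ms , d′ ← ∈↓-block⁻ d =
  ++⁺ (over-⊆-power (ℕ.≤-trans (List.length-++-≤ˡ u) l) ms)
      (short-⊆-unfold T (ℕ.≤-trans (List.length-++-≤ʳ v {u}) l) d′)

-- Reading a word outside ↓T greedily along T and recording one letter whenever T
-- advances by a symbol produces one of these candidates.
obstructionCandidates : Template k → List (Word k)
obstructionCandidates []      = map [_] (allFin _)
obstructionCandidates (t ∷ T) =
  obstructionCandidates T ++ cartesianProductWith _∷_ (allFin _) (obstructionCandidates T)

private
  -- For a letter `a` that `t` cannot read. If the obstruction for `T` embeds without using this
  -- `a`, then `a` is put in front; if it begins at this `a`, it stays unchanged, since `f` already
  -- forces it past `t`.
  advance : (∃ λ x → x ∈ obstructionCandidates T × x ⊆ a ∷ w × ¬ (x ∈↓ T)) →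
            (∀ {x} → a ∷ x ∈↓ t ∷ T → a ∷ x ∈↓ T) →
            ∃ λ x → x ∈ obstructionCandidates (t ∷ T) × x ⊆ a ∷ w × ¬ (x ∈↓ t ∷ T)
  advance {T = T} (x , m , a ∷ʳ e , ¬x) f =
    a ∷ x , ∈-++⁺ʳ (obstructionCandidates T) (∈-cartesianProductWith⁺ _∷_ (∈-allFin a) m) ,
    refl ∷ e , ¬x ∘ ∈↓-down (a ∷ʳ ⊆-refl) ∘ f
  advance (x , m , refl ∷ e , ¬x) f = x , ∈-++⁺ˡ m , refl ∷ e , ¬x ∘ f

Obstructed : Template k → Set
Obstructed T = ∀ w → ¬ (w ∈↓ T) → ∃ λ x → x ∈ obstructionCandidates T × x ⊆ w × ¬ (x ∈↓ T)

obstructed-∷ : ∀ (t : Symbol k) → Obstructed T → Obstructed (t ∷ T)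
obstructed-∷ t          ob []      ¬d = contradiction (empty-∈↓ _) ¬d
obstructed-∷ {T = T} (letter a) ob (c ∷ w) ¬d with c Fin.≟ a
... | yes refl with x , m , e , ¬x ← ob w (¬d ∘ take) =
  c ∷ x , ∈-++⁺ʳ (obstructionCandidates T) (∈-cartesianProductWith⁺ _∷_ (∈-allFin c) m) ,
  refl ∷ e , λ where
    (omit d) → ¬x (∈↓-down (c ∷ʳ ⊆-refl) d)
    (take d) → ¬x d
... | no c≢a = advance (ob (c ∷ w) (¬d ∘ omit)) λ where
    (omit d) → d
    (take _) → contradiction refl c≢a
obstructed-∷ (block B) ob (c ∷ w) ¬d with c ∈? B
-- A letter that the block reads is not recorded: the block stays current, so an obstruction in the
-- rest of the word serves for the whole.
... | yes m with x , m′ , e , ¬x ← obstructed-∷ (block B) ob w (¬d ∘ stay m) =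
  x , m′ , c ∷ʳ e , ¬x
... | no ¬m = advance (ob (c ∷ w) (¬d ∘ exit)) λ where
    (exit d)   → d
    (stay m _) → contradiction m ¬m

obstructed : (T : Template k) → Obstructed T
obstructed []      []      ¬d = contradiction done ¬d
obstructed []      (a ∷ w) ¬d =
  [ a ] , ∈-map⁺ [_] (∈-allFin a) , refl ∷ minimum w , λ ()
obstructed (t ∷ T) w       ¬d = obstructed-∷ t (obstructed T) w ¬d

-- Finitely many templates describe all words.

remove : Fin k → Word k → Word k
remove a = filter (λ b → ¬? (b Fin.≟ a))

-- A word without the subword s = s₁ s₂ ⋯ is cut at the leftmost embedding of the
-- longest possible prefix of s; the factor before s_i does not contain s_i, so R
-- describes it over a smaller alphabet.
templatesAvoiding : (Word k → List (Template k)) → Word k → Word k → List (Template k)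
templatesAvoiding R []      B = []
templatesAvoiding R (a ∷ s) B =
  R (remove a B) ++
  cartesianProductWith (λ T T′ → T ++ letter a ∷ T′) (R (remove a B)) (templatesAvoiding R s B)

-- Either the word contains `B ^ N`, or it is cut into letters and factors over alphabets with a
-- letter removed. The number `n` makes the recursion structural; as long as it bounds the length of
-- `B`, the alphabet at `zero` is empty.
templatesOver : ℕ → ℕ → Word k → List (Template k)
templatesOver N zero    B = [ [ block B ] ]
templatesOver N (suc n) B = [ block B ] ∷ templatesAvoiding (templatesOver N n) (B ^ N) B

over-remove : a ∉ u → u over B → u over remove a B
over-remove ∉u []       = []
over-remove ∉u (m ∷ ms) =
  ∈-filter⁺ _ m (∉u ∘ here ∘ sym) ∷ over-remove (∉u ∘ there) ms

splitFirst : a ∈ w → ∃₂ λ u v → w ≡ u ++ a ∷ v × a ∉ u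
splitFirst {a = a} {w = b ∷ w} m with a Fin.≟ b
... | yes refl = [] , w , refl , λ ()
splitFirst (here refl) | no a≢b = contradiction refl a≢b
splitFirst (there m)   | no a≢b with u , v , refl , ∉u ← splitFirst m =
  _ ∷ u , v , refl , λ where
    (here refl) → a≢b refl
    (there m)   → ∉u m

unfold-++ : ∀ N (T : Template k) T′ → unfold N (T ++ T′) ≡ unfold N T ++ unfold N T′
unfold-++ N T T′ = List.concatMap-++ (expand N) T T′

∈⟨⟩-join : u ∈⟨ N ⟩ T → v ∈⟨ N ⟩ T′ → u ++ a ∷ v ∈⟨ N ⟩ (T ++ letter a ∷ T′)
∈⟨⟩-join {N = N} {T = T} {T′ = T′} (d , e) (d′ , e′) =
  ∈↓-++ d (take d′) ,
  subst (_⊆ _) (sym (unfold-++ N T (letter _ ∷ T′))) (++⁺ e (refl ∷ e′))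

templatesAvoiding-complete :
  (R : Word k → List (Template k)) →
  (∀ {a} → a ∈ B → ∀ {u} → u over remove a B → ∃[ T ] T ∈ R (remove a B) × u ∈⟨ N ⟩ T) →
  ∀ {s} → s over B → w over B →
  s ⊆ w ⊎ ∃[ T ] T ∈ templatesAvoiding R s B × w ∈⟨ N ⟩ T
templatesAvoiding-complete R cover [] ws = inj₁ (minimum _)
templatesAvoiding-complete {w = w} R cover {a ∷ s} (m ∷ ms) ws with a ∈? w
... | no a∉w with T , T∈ , p ← cover m (over-remove a∉w ws) = inj₂ (T , ∈-++⁺ˡ T∈ , p)
... | yes a∈w with u , v , refl , a∉u ← splitFirst a∈w
    with us , _ ∷ vs ← All.++⁻ u ws
    with templatesAvoiding-complete R cover ms vs
...   | inj₁ e = inj₁ (++⁺ˡ u (refl ∷ e))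
...   | inj₂ (T′ , T′∈ , q) with T , T∈ , p ← cover m (over-remove a∉u us) =
  inj₂ (_ , ∈-++⁺ʳ _ (∈-cartesianProductWith⁺ _ T∈ T′∈) , ∈⟨⟩-join p q)

power-over : ∀ N → B ^ N over B
power-over zero    = []
power-over (suc N) = All.++⁺ (All.tabulate id) (power-over N)

∈⟨⟩-block : w over B → B ^ N ⊆ w → w ∈⟨ N ⟩ [ block B ]
∈⟨⟩-block {w = w} {B = B} {N = N} ws e =
  subst (_∈↓ _) (List.++-identityʳ w) (∈↓-over ws (exit done)) ,
  subst (_⊆ w) (sym (List.++-identityʳ (B ^ N))) e

power-[] : ∀ N → _^_ {k} [] N ≡ []
power-[] zero    = refl
power-[] (suc N) = power-[] N

templatesOver-complete : ∀ N n → length B ≤ n → w over B →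
                         ∃[ T ] T ∈ templatesOver N n B × w ∈⟨ N ⟩ T
templatesOver-complete {B = []} N zero _ ws =
  _ , here refl , ∈⟨⟩-block ws (subst (_⊆ _) (sym (power-[] N)) (minimum _))
templatesOver-complete {B = B} N (suc n) l ws
  with templatesAvoiding-complete (templatesOver N n)
         (λ m → templatesOver-complete N n
           (s≤s⁻¹ (ℕ.≤-trans (List.filter-notAll _ B (Any.map (λ eq ¬eq → ¬eq (sym eq)) m)) l)))
         (power-over N) ws
... | inj₁ e             = _ , here refl , ∈⟨⟩-block ws e
... | inj₂ (T , T∈ , p) = T , there T∈ , p

-- Reduced templates and absorption.

firstAbsorbs : Template k → Word k
firstAbsorbs (block B ∷ _) = B
firstAbsorbs _             = []

letters : Symbol k → Word k
letters (letter a) = [ a ]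
letters (block B)  = B

HeadNotOver : Word k → Template k → Set
HeadNotOver B []      = ⊤
HeadNotOver B (t ∷ _) = ¬ (letters t over B)

-- The empty word is over every alphabet, so a reduced template has no block with empty alphabet.
data Reduced {k} : Template k → Set where
  []      : Reduced []
  letter∷ : a ∉ firstAbsorbs T → Reduced T → Reduced (letter a ∷ T)
  block∷  : ¬ (B over firstAbsorbs T) → HeadNotOver B T → Reduced T → Reduced (block B ∷ T)

-- The left template is the coarser one: for each `N`, every word of `T` is a word of `T′`, so
-- replacing `T` by `T′` loses no words.
record _⊑_ {k} (T′ T : Template k) : Set where
  constructor _,_
  field
    below-mono : ∀ {w} → w ∈↓ T → w ∈↓ T′
    unfold-⊆   : ∀ N → unfold N T′ ⊆ unfold N T

∈⟨⟩-mono : T′ ⊑ T → w ∈⟨ N ⟩ T → w ∈⟨ N ⟩ T′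
∈⟨⟩-mono (f , g) (d , e) = f d , ⊆-trans (g _) e

⊑-refl : T ⊑ T
⊑-refl = id , λ _ → ⊆-refl

⊑-trans : ∀ {T₁ T₂ T₃ : Template k} → T₁ ⊑ T₂ → T₂ ⊑ T₃ → T₁ ⊑ T₃
⊑-trans (f , g) (f′ , g′) = f ∘ f′ , λ N → ⊆-trans (g N) (g′ N)

⊑-∷ : ∀ t → T′ ⊑ T → t ∷ T′ ⊑ t ∷ T
⊑-∷ {T′ = T′} {T = T} t (f , g) = below t , λ N → ++⁺ {as = expand N t} ⊆-refl (g N)
  where
  below : ∀ t {w} → w ∈↓ t ∷ T → w ∈↓ t ∷ T′
  below (letter _) (omit d)   = omit (f d)
  below (letter _) (take d)   = take (f d)
  below (block _)  (exit d)   = exit (f d)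
  below (block _)  (stay m d) = stay m (below (block _) d)

absorb-∷ : a ∈ firstAbsorbs T → w ∈↓ T → a ∷ w ∈↓ T
absorb-∷ {T = block _ ∷ _} m d = stay m d

absorbʳ : ∀ t → letters t over firstAbsorbs T → T ⊑ t ∷ T
absorbʳ {T = T} t ms = below t ms , λ N → ++⁺ˡ (expand N t) ⊆-refl
  where
  below : ∀ t → letters t over firstAbsorbs T → ∀ {w} → w ∈↓ t ∷ T → w ∈↓ T
  below (letter _) _        (omit d)   = d
  below (letter _) (m ∷ _) (take d)   = absorb-∷ m d
  below (block _)  _        (exit d)   = d
  below (block _)  ms       (stay m d) = absorb-∷ (All.lookup ms m) (below (block _) ms d)

absorbˡ : ∀ t → letters t over B → block B ∷ T ⊑ block B ∷ t ∷ T
absorbˡ {B = B} {T = T} t ms = below , λ N → ++⁺ {as = B ^ N} ⊆-refl (++⁺ˡ (expand N t) ⊆-refl)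
  where
  inner : ∀ t → letters t over B → ∀ {w} → w ∈↓ t ∷ T → w ∈↓ block B ∷ T
  inner (letter _) _        (omit d)   = exit d
  inner (letter _) (m ∷ _) (take d)   = stay m (exit d)
  inner (block _)  _        (exit d)   = exit d
  inner (block _)  ms       (stay m d) = stay (All.lookup ms m) (inner (block _) ms d)
  below : ∀ {w} → w ∈↓ block B ∷ t ∷ T → w ∈↓ block B ∷ T
  below (exit d)   = inner t ms d
  below (stay m d) = stay m (below d)

reduced-tail : Reduced (t ∷ T) → Reduced T
reduced-tail (letter∷ _ r)  = r
reduced-tail (block∷ _ _ r) = r

reduce-∷ : ∀ t → Reduced T → ∃[ T′ ] Reduced T′ × T′ ⊑ t ∷ T
reduce-∷ {T = T} t r with letters t over? firstAbsorbs T
... | yes ms = T , r , absorbʳ t ms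
reduce-∷ (letter a) r | no ¬ms = _ , letter∷ (¬ms ∘ (_∷ [])) r , ⊑-refl
reduce-∷ {T = []} (block B) r | no ¬ms = _ , block∷ ¬ms tt r , ⊑-refl
reduce-∷ {T = t ∷ T} (block B) r | no ¬ms with letters t over? B
... | no ¬ns = _ , block∷ ¬ms ¬ns r , ⊑-refl
-- Having absorbed `t`, the block may absorb further symbols or be absorbed by what follows, so it
-- is compared with the rest again.
... | yes ns with T′ , r′ , T′⊑ ← reduce-∷ {T = T} (block B) (reduced-tail r) =
  T′ , r′ , ⊑-trans T′⊑ (absorbˡ t ns)

reduce : (T : Template k) → ∃[ T′ ] Reduced T′ × T′ ⊑ T
reduce []      = [] , [] , ⊑-refl
reduce (t ∷ T) with T₁ , r₁ , p₁ ← reduce T with T₂ , r₂ , p₂ ← reduce-∷ t r₁ =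
  T₂ , r₂ , ⊑-trans p₂ (⊑-∷ t p₁)

-- An excess `s` that the first symbol cannot absorb uses that symbol up. A copy from the symbol's
-- own expansion then becomes an excess for the rest, which by reducedness cannot absorb it either;
-- at the end of the template a nonempty excess is left.
overflow : ∀ (s : Word k) T → ¬ (s over firstAbsorbs T) → Reduced T →
           ¬ (s ++ unfold (suc N) T ∈↓ T)
overflow []      _  ¬s _ _ = ¬s []
overflow (a ∷ s) [] ¬s _ ()
overflow {N = N} (a ∷ s) (letter b ∷ T) _ (letter∷ b∉ r) d =
  overflow [ b ] T (λ { (m ∷ []) → b∉ m }) r (∈↓-down (++⁺ˡ s ⊆-refl) (tail d))
  where
  tail : a ∷ u ∈↓ letter b ∷ T → u ∈↓ T
  tail (omit d) = ∈↓-down (_ ∷ʳ ⊆-refl) d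
  tail (take d) = d
overflow {N = N} s (block C ∷ T) ¬s (block∷ ¬c _ r) d =
  overflow C T ¬c r (∈↓-down (++⁺ (++⁺ʳ (C ^ N) (⊆-refl {x = C})) ⊆-refl) (drain s ¬s d))
  where
  drain : ∀ s → ¬ (s over C) → s ++ u ∈↓ block C ∷ T → u ∈↓ T
  drain []      ¬s d          = contradiction [] ¬s
  drain (a ∷ s) ¬s (exit d)   = ∈↓-down (++⁺ˡ (a ∷ s) ⊆-refl) d
  drain (a ∷ s) ¬s (stay m d) = drain s (¬s ∘ (m ∷_)) d

-- Factorisations along reduced templates.

data Exact {k} (N : ℕ) : Word k → Template k → Set where
  []     : Exact N [] []
  letter : Exact N w T → Exact N (a ∷ w) (letter a ∷ T)
  block  : u over B → B ^ N ⊆ u → Exact N w T → Exact N (u ++ w) (block B ∷ T)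

exact⇒∈⟨⟩ : Exact N w T → w ∈⟨ N ⟩ T
exact⇒∈⟨⟩ []             = done , []
exact⇒∈⟨⟩ (letter x)     with d , e ← exact⇒∈⟨⟩ x = take d , refl ∷ e
exact⇒∈⟨⟩ (block us f x) with d , e ← exact⇒∈⟨⟩ x = ∈↓-over us (exit d) , ++⁺ f e

-- One copy of a block's alphabet is given up, because the copies belonging to
-- the previous block may reach into it.
trimmedUnfold : ℕ → Template k → Word k
trimmedUnfold N []      = []
trimmedUnfold N (t ∷ T) = expand (suc N) t ++ unfold (suc (suc N)) T

trimmed-⊆ : ∀ T → trimmedUnfold N T ⊆ unfold {k} (suc (suc N)) T
trimmed-⊆         []             = []
trimmed-⊆         (letter _ ∷ T) = ⊆-refl
trimmed-⊆ {N = N} (block B ∷ T)  = ++⁺ (power-⊆ B (suc N)) ⊆-refl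

⊆-split-either : ∀ x v → x ++ v ⊆ u ++ w → x ⊆ u ⊎ v ⊆ w
⊆-split-either {u = []}    x       v e          = inj₂ (⊆-trans (++⁺ˡ x ⊆-refl) e)
⊆-split-either {u = _ ∷ u} []      v e          = inj₁ (minimum _)
⊆-split-either {u = c ∷ u} (a ∷ x) v (_ ∷ʳ e) with ⊆-split-either (a ∷ x) v e
... | inj₁ f = inj₁ (c ∷ʳ f)
... | inj₂ f = inj₂ f
⊆-split-either {u = c ∷ u} (a ∷ x) v (p ∷ e) with ⊆-split-either x v e
... | inj₁ f = inj₁ (p ∷ f)
... | inj₂ f = inj₂ f

-- Some letter of `s` is outside `B`, so it is matched in `w`, and all of `v` comes after it.
cut-over : ∀ s → ¬ (s over B) → u over B → s ++ v ⊆ u ++ w → v ⊆ w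
cut-over []      ¬s us e = contradiction [] ¬s
cut-over (a ∷ s) ¬s []       e        = ⊆-trans (++⁺ˡ (a ∷ s) ⊆-refl) e
cut-over (a ∷ s) ¬s (_ ∷ us) (_ ∷ʳ e) = cut-over (a ∷ s) ¬s us e
cut-over (a ∷ s) ¬s (m ∷ us) (refl ∷ e) = cut-over s (¬s ∘ (m ∷_)) us e

cut-letter : ¬ (a ∈ B) → u over B → a ∷ v ⊆ u ++ w → a ∷ v ⊆ w
cut-letter a∉ []       e          = e
cut-letter a∉ (_ ∷ us) (_ ∷ʳ e)   = cut-letter a∉ us e
cut-letter a∉ (m ∷ us) (refl ∷ e) = contradiction m a∉

-- A block after `u` loses at most its first copy: that copy has a letter outside `B`, which is
-- matched in `w`. A letter loses nothing.
cut-template : ∀ T → HeadNotOver B T → u over B → unfold (suc (suc N)) T ⊆ u ++ w →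
               trimmedUnfold N T ⊆ w
cut-template []             _  us e = minimum _
cut-template (letter a ∷ T) ¬a us e = cut-letter (¬a ∘ (_∷ [])) us e
cut-template {N = N} (block C ∷ T) ¬C us e =
  cut-over C ¬C us (subst (_⊆ _) (List.++-assoc C (C ^ suc N) _) e)

power-snoc : (B : Word k) → ∀ N → B ^ suc N ≡ B ^ N ++ B
power-snoc B zero    = List.++-identityʳ B
power-snoc B (suc N) = trans (cong (B ++_) (power-snoc B N)) (sym (List.++-assoc B (B ^ N) B))

-- The factorisation is read off from `w ∈↓ T`; `overflow` excludes that a letter is omitted or that
-- a block stops too early.
exact : {T : Template k} → Reduced T → w ∈↓ T → trimmedUnfold N T ⊆ w → Exact N w T
exact [] done _ = []
exact {T = letter a ∷ T} (letter∷ a∉ r) (omit d) e =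
  contradiction (∈↓-down e d) (overflow [ a ] T (λ { (m ∷ []) → a∉ m }) r)
exact {T = letter a ∷ T} (letter∷ _ r) (take d) e =
  letter (exact r d (⊆-trans (trimmed-⊆ T) (∷⁻ e)))
exact {N = N} {T = block B ∷ T} (block∷ ¬B ¬T r) d e
  with u , v , refl , us , d′ ← ∈↓-block⁻ d
  -- The last of the `suc N` copies is the reserve: if the first `N` do not fit into `u`, then this
  -- copy and the unfolding of `T` both lie in `v`, which overflows `T`.
  with ⊆-split-either (B ^ N) (B ++ unfold (suc (suc N)) T) (subst (_⊆ _) reassoc e)
  where
  reassoc : B ^ suc N ++ unfold (suc (suc N)) T ≡ B ^ N ++ B ++ unfold (suc (suc N)) T
  reassoc = trans (cong (_++ _) (power-snoc B N)) (List.++-assoc (B ^ N) B _)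
... | inj₁ f = block us f
  (exact r d′ (cut-template T ¬T us (⊆-trans (++⁺ˡ (B ^ suc N) ⊆-refl) e)))
... | inj₂ f = contradiction (∈↓-down f d′) (overflow B T ¬B r)

-- Reachability and paths along templates

⊆-++⁻ : ∀ x → x ++ v ⊆ w → ∃₂ λ w₁ w₂ → w ≡ w₁ ++ w₂ × x ⊆ w₁ × v ⊆ w₂
⊆-++⁻ []      e          = [] , _ , refl , [] , e
⊆-++⁻ (a ∷ x) (c ∷ʳ e)   with w₁ , w₂ , refl , f , g ← ⊆-++⁻ (a ∷ x) e =
  c ∷ w₁ , w₂ , refl , c ∷ʳ f , g
⊆-++⁻ (a ∷ x) (refl ∷ e) with w₁ , w₂ , refl , f , g ← ⊆-++⁻ x e =
  a ∷ w₁ , w₂ , refl , refl ∷ f , g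

module Warshall {n : ℕ} {E : Rel (Fin n) 0ℓ} (E? : Binary.Decidable E) where

  private
    variable
      q r s : Fin n
      vs : List (Fin n)

  -- Warshall's relation: paths whose intermediate vertices come from the list, with one more vertex
  -- allowed at each step. No path has to pass the newest vertex twice.
  Via : List (Fin n) → Rel (Fin n) 0ℓ
  Via []       q r = q ≡ r ⊎ E q r
  Via (v ∷ vs) q r = Via vs q r ⊎ (Via vs q v × Via vs v r)

  via? : ∀ vs → Binary.Decidable (Via vs)
  via? []       q r = (q Fin.≟ r) ⊎-dec E? q r
  via? (v ∷ vs) q r = via? vs q r ⊎-dec (via? vs q v ×-dec via? vs v r)

  via-base : ∀ vs → q ≡ r ⊎ E q r → Via vs q r
  via-base []       e = e
  via-base (_ ∷ vs) e = inj₁ (via-base vs e)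

  via-trans : s ∈ vs → Via vs q s → Via vs s r → Via vs q r
  -- Detours that return to the newest vertex `s` are dropped, from the end of the first path by
  -- `upTo` and from the start of the second by `from`.
  via-trans (here refl) p            q            = inj₂ (upTo p , from q)
    where
    upTo : ∀ {q s} → Via (s ∷ vs) q s → Via vs q s
    upTo (inj₁ p)       = p
    upTo (inj₂ (p , _)) = p
    from : ∀ {s r} → Via (s ∷ vs) s r → Via vs s r
    from (inj₁ p)       = p
    from (inj₂ (_ , p)) = p
  via-trans (there m) (inj₁ p)        (inj₁ q)        = inj₁ (via-trans m p q)
  via-trans (there m) (inj₁ p)        (inj₂ (q , q′)) = inj₂ (via-trans m p q , q′)
  via-trans (there m) (inj₂ (p , p′)) (inj₁ q)        = inj₂ (p , via-trans m p′ q)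
  via-trans (there m) (inj₂ (p , _))  (inj₂ (_ , q′)) = inj₂ (p , q′)

  via⇒star : ∀ vs → Via vs q r → Star E q r
  via⇒star []       (inj₁ refl)     = stop
  via⇒star []       (inj₂ e)        = e ◅ stop
  via⇒star (_ ∷ vs) (inj₁ p)        = via⇒star vs p
  via⇒star (_ ∷ vs) (inj₂ (p , p′)) = via⇒star vs p ◅◅ via⇒star vs p′

  star⇒via : Star E q r → Via (allFin n) q r
  star⇒via stop        = via-base (allFin n) (inj₁ refl)
  star⇒via (e ◅ es) =
    via-trans (∈-allFin _) (via-base (allFin n) (inj₂ e)) (star⇒via es)

  star? : Binary.Decidable (Star E)
  star? q r = map′ (via⇒star (allFin n)) star⇒via (via? (allFin n) q r)

module Paths {k : ℕ} (𝒜 : NFA k) where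
  open NFA 𝒜

  private
    variable
      q r s : Fin states

  Run : Fin states → Word k → Fin states → Set
  Run q []      r = q ≡ r
  Run q (a ∷ w) r = ∃[ q′ ] q′ ∈ˢ δ q a × Run q′ w r

  Run-++⁺ : ∀ u → Run q u r → Run r v s → Run q (u ++ v) s
  Run-++⁺ []      refl          y = y
  Run-++⁺ (a ∷ u) (q′ , e , x) y = q′ , e , Run-++⁺ u x y

  Run-++⁻ : ∀ u → Run q (u ++ v) s → ∃[ r ] Run q u r × Run r v s
  Run-++⁻ []      y = _ , refl , y
  Run-++⁻ (a ∷ u) (q′ , e , x) with r , y , z ← Run-++⁻ u x = r , (q′ , e , y) , z

  accepts⇒run : ∀ w → AcceptsFrom q w → ∃[ r ] r ∈ˢ final × Run q w r
  accepts⇒run []      f = _ , f , refl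
  accepts⇒run (a ∷ w) (q′ , e , x) with r , f , y ← accepts⇒run w x = r , f , q′ , e , y

  run⇒accepts : ∀ w → Run q w r → r ∈ˢ final → AcceptsFrom q w
  run⇒accepts []      refl         f = f
  run⇒accepts (a ∷ w) (q′ , e , x) f = q′ , e , run⇒accepts w x f

  Step : Word k → Rel (Fin states) 0ℓ
  Step B q r = Any (λ a → r ∈ˢ δ q a) B

  Reach : Word k → Rel (Fin states) 0ℓ
  Reach B = Star (Step B)

  Visits : Word k → Fin states → Fin states → Fin k → Set
  Visits B q r b = ∃[ s ] ∃[ s′ ] Reach B q s × s′ ∈ˢ δ s b × Reach B s′ r

  Covers : Word k → Rel (Fin states) 0ℓ
  Covers B q r = All (Visits B q r) B

  BlockPath : Word k → Rel (Fin states) 0ℓ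
  BlockPath B q r = ∃[ s ] Reach B q s × Covers B s s × Reach B s r

  Path : Template k → Rel (Fin states) 0ℓ
  Path []             q r = q ≡ r
  Path (letter a ∷ T) q r = ∃[ s ] s ∈ˢ δ q a × Path T s r
  Path (block B ∷ T)  q r = ∃[ s ] BlockPath B q s × Path T s r

  AcceptingPath : Template k → Set
  AcceptingPath T = ∃[ q ] ∃[ r ] q ∈ˢ initial × r ∈ˢ final × Path T q r

  reach? : ∀ B → Binary.Decidable (Reach B)
  reach? B = Warshall.star? λ q r → Any.any? (λ a → r ∈ˢ? δ q a) B

  visits? : ∀ B q r → Decidable (Visits B q r)
  visits? B q r b = Fin.any? λ s → Fin.any? λ s′ →
    reach? B q s ×-dec s′ ∈ˢ? δ s b ×-dec reach? B s′ r

  path? : ∀ T → Binary.Decidable (Path T)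
  path? []             q r = q Fin.≟ r
  path? (letter a ∷ T) q r = Fin.any? λ s → s ∈ˢ? δ q a ×-dec path? T s r
  path? (block B ∷ T)  q r = Fin.any? λ s →
    (Fin.any? λ s′ → reach? B q s′ ×-dec All.all? (visits? B s′ s′) B ×-dec reach? B s′ s)
    ×-dec path? T s r

  acceptingPath? : Decidable AcceptingPath
  acceptingPath? T = Fin.any? λ q → Fin.any? λ r →
    q ∈ˢ? initial ×-dec r ∈ˢ? final ×-dec path? T q r

  reach⇒run : Reach B q r → ∃[ u ] u over B × Run q u r
  reach⇒run stop = [] , [] , refl
  reach⇒run (m ◅ p) with u , us , x ← reach⇒run p with a , a∈ , e ← find m =
    a ∷ u , a∈ ∷ us , _ , e , x

  run⇒reach : u over B → Run q u r → Reach B q r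
  run⇒reach []       refl        = stop
  run⇒reach (m ∷ us) (_ , e , x) = lose m e ◅ run⇒reach us x

  -- The loops for the letters of `C` are run one after the other, so `C` appears as a subword in
  -- its own order. It is kept apart from `B` for the induction, in which the loops still use all of
  -- `B`.
  tour : ∀ {C} → C over B → All (Visits B s s) C → ∃[ u ] u over B × C ⊆ u × Run s u s
  tour []       []                           = [] , [] , [] , refl
  tour (m ∷ ms) ((_ , _ , p , e , p′) ∷ vs)
    with u , us , x ← reach⇒run p
    with v , vs′ , y ← reach⇒run p′
    with w , ws , f , z ← tour ms vs =
    u ++ _ ∷ v ++ w , All.++⁺ us (m ∷ All.++⁺ vs′ ws) ,
    ++⁺ˡ u (refl ∷ ++⁺ˡ v f) , Run-++⁺ u x (_ , e , Run-++⁺ v y z)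

  tours : ∀ N → Covers B s s → ∃[ u ] u over B × B ^ N ⊆ u × Run s u s
  tours zero    c = [] , [] , [] , refl
  tours (suc N) c
    with u , us , f , x ← tour (All.tabulate id) c
    with v , vs , g , y ← tours N c =
    u ++ v , All.++⁺ us vs , ++⁺ f g , Run-++⁺ u x y

  pump : ∀ N T → Path T q r → ∃[ w ] Exact N w T × Run q w r
  pump N []             refl = [] , [] , refl
  pump N (letter a ∷ T) (_ , e , p) with w , x , y ← pump N T p =
    a ∷ w , letter x , _ , e , y
  pump N (block B ∷ T)  (_ , (s , p₁ , c , p₂) , p)
    with u₁ , us₁ , x₁ ← reach⇒run p₁
    with u₂ , us₂ , f , x₂ ← tours N c
    with u₃ , us₃ , x₃ ← reach⇒run p₂
    with w , x , y ← pump N T p =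
    (u₁ ++ u₂ ++ u₃) ++ w ,
    block (All.++⁺ us₁ (All.++⁺ us₂ us₃)) (++⁺ˡ u₁ (++⁺ʳ u₃ f)) x ,
    Run-++⁺ (u₁ ++ u₂ ++ u₃) (Run-++⁺ u₁ x₁ (Run-++⁺ u₂ x₂ x₃)) y

  -- A run over a block, cut into `N` pieces that each meet all letters of `B`, and a remainder. The
  -- `suc N` starting states are those for the pigeonhole.
  data Chain (B : Word k) : ℕ → Rel (Fin states) 0ℓ where
    end  : Reach B q r → Chain B zero q r
    link : Reach B q s → Covers B q s → Chain B N s r → Chain B (suc N) q r

  state : Chain B N q r → Fin (suc N) → Fin states
  state {q = q} _          zero    = q
  state         (link _ _ c) (suc i) = state c i

  reach-state : (c : Chain B N q r) → ∀ i → Reach B q (state c i)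
  reach-state c            zero    = stop
  reach-state (link p _ c) (suc i) = p ◅◅ reach-state c i

  state-reach : (c : Chain B N q r) → ∀ i → Reach B (state c i) r
  state-reach (end p)      zero    = p
  state-reach (link p _ c) zero    = p ◅◅ state-reach c zero
  state-reach (link _ _ c) (suc i) = state-reach c i

  -- The piece that starts at the earlier state already meets every letter; the pieces up to the
  -- later state only prolong it.
  covers-states : (c : Chain B N q r) → ∀ {i j} → i < j → Covers B (state c i) (state c j)
  covers-states (link _ v c) {zero}  {suc j} _         =
    All.map (λ (_ , _ , p , e , p′) → _ , _ , p , e , p′ ◅◅ reach-state c j) v
  covers-states (link _ _ c) {suc i} {suc j} (s≤s i<j) = covers-states c i<j

  chain⇒blockPath : states ≤ N → Chain B N q r → BlockPath B q r
  -- With at most `N` states, two of the `suc N` recorded ones coincide, and the pieces between them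
  -- form a loop that meets every letter.
  chain⇒blockPath {B = B} l c with i , j , i<j , eq ← Fin.pigeonhole (s≤s l) (state c) =
    state c i , reach-state c i ,
    subst (Covers B (state c i)) (sym eq) (covers-states c i<j) , state-reach c i

  run⇒visits : u over B → Run q u r → a ∈ u → Visits B q r a
  run⇒visits us x m with u₁ , u₂ , refl ← ∈-∃++ m
    with s , x₁ , s′ , e , x₂ ← Run-++⁻ u₁ x
    with us₁ , _ ∷ us₂ ← All.++⁻ u₁ us =
    s , s′ , run⇒reach us₁ x₁ , e , run⇒reach us₂ x₂

  run⇒chain : ∀ N → u over B → B ^ N ⊆ u → Run q u r → Chain B N q r
  run⇒chain zero    us f x = end (run⇒reach us x)
  run⇒chain {B = B} (suc N) us f x
    with u , v , refl , g , h ← ⊆-++⁻ B f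
    with us₁ , us₂ ← All.++⁻ u us
    with s , x₁ , x₂ ← Run-++⁻ u x =
    link (run⇒reach us₁ x₁) (All.tabulate (run⇒visits us₁ x₁ ∘ Any-resp-⊆ g))
         (run⇒chain N us₂ h x₂)

  exact⇒path : states ≤ N → Exact N w T → Run q w r → Path T q r
  exact⇒path l []          refl        = refl
  exact⇒path l (letter x)  (s , e , y) = s , e , exact⇒path l x y
  exact⇒path l (block {u = u} us f x) y with s , y₁ , y₂ ← Run-++⁻ u y =
    s , chain⇒blockPath l (run⇒chain _ us f y₁) , exact⇒path l x y₂

-- Definability in BΣ₁ and invariance under Simon's congruence

position : x ⊆ u → Fin (length x) → Fin (length u)
position (_ ∷ʳ e) i       = suc (position e i)
position (_ ∷ e)  zero    = zero
position (_ ∷ e)  (suc i) = suc (position e i)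

position-refl : ∀ (x : Word k) i → position (⊆-refl {x = x}) i ≡ i
position-refl (_ ∷ x) zero    = refl
position-refl (_ ∷ x) (suc i) = cong suc (position-refl x i)

lookup-position : (e : x ⊆ u) → ∀ i → lookup u (position e i) ≡ lookup x i
lookup-position (_ ∷ʳ e)   i       = lookup-position e i
lookup-position (refl ∷ e) zero    = refl
lookup-position (_ ∷ e)    (suc i) = lookup-position e i

position-mono : (e : x ⊆ u) → ∀ {i j} → i < j → position e i < position e j
position-mono (_ ∷ʳ e) i<j                         = s<s (position-mono e i<j)
position-mono (_ ∷ e)  {zero}  {suc j} _           = s≤s z≤n
position-mono (_ ∷ e)  {suc i} {suc j} (s≤s i<j)   = s<s (position-mono e i<j)

position-cancel : (e : x ⊆ u) → ∀ i j → position e i < position e j → i < j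
position-cancel (_ ∷ʳ e) i       j       p = position-cancel e i j (s<s⁻¹ p)
position-cancel (_ ∷ e)  zero    (suc j) p = s≤s z≤n
position-cancel (_ ∷ e)  (suc i) (suc j) p = s<s (position-cancel e i j (s<s⁻¹ p))

module _ {x u : Word k} (e : x ⊆ u) where

  Tracks : Vector (Fin (length u)) n → Vector (Fin (length x)) n → Set
  Tracks ρ σ = ∀ i → ρ i ≡ position e (σ i)

  tracks-∷ : {ρ : Vector (Fin (length u)) n} {σ : Vector (Fin (length x)) n} →
             Tracks ρ σ → ∀ i → Tracks (position e i Vector.∷ ρ) (i Vector.∷ σ)
  tracks-∷ h i zero    = refl
  tracks-∷ h i (suc j) = h j

  -- An embedding preserves and reflects labels and order. The two directions are mutual because
  -- negation exchanges them.
  qf-extend : {ρ : Vector (Fin (length u)) n} {σ : Vector (Fin (length x)) n} →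
              Tracks ρ σ → QuantifierFree φ → Sat x σ φ → Sat u ρ φ
  qf-restrict : {ρ : Vector (Fin (length u)) n} {σ : Vector (Fin (length x)) n} →
                Tracks ρ σ → QuantifierFree φ → Sat u ρ φ → Sat x σ φ

  qf-extend h ⊤-qf       s        = s
  qf-extend h (P-qf a i) s        = trans (cong (lookup u) (h i)) (trans (lookup-position e _) s)
  qf-extend h (<-qf i j) s        = subst₂ _<_ (sym (h i)) (sym (h j)) (position-mono e s)
  qf-extend h (¬-qf p)   s        = s ∘ qf-restrict h p
  qf-extend h (∧-qf p q) (s , s′) = qf-extend h p s , qf-extend h q s′
  qf-extend h (∨-qf p q) s        = Sum.map (qf-extend h p) (qf-extend h q) s

  qf-restrict h ⊤-qf       s        = s
  qf-restrict h (P-qf a i) s        =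
    trans (sym (lookup-position e _)) (trans (cong (lookup u) (sym (h i))) s)
  qf-restrict h (<-qf i j) s        = position-cancel e _ _ (subst₂ _<_ (h i) (h j) s)
  qf-restrict h (¬-qf p)   s        = s ∘ qf-extend h p
  qf-restrict h (∧-qf p q) (s , s′) = qf-restrict h p s , qf-restrict h q s′
  qf-restrict h (∨-qf p q) s        = Sum.map (qf-restrict h p) (qf-restrict h q) s

  Σ₁-extend : {ρ : Vector (Fin (length u)) n} {σ : Vector (Fin (length x)) n} →
              Tracks ρ σ → IsΣ₁ φ → Sat x σ φ → Sat u ρ φ
  Σ₁-extend h (matrix p) s       = qf-extend h p s
  Σ₁-extend h (exists p) (i , s) = position e i , Σ₁-extend (tracks-∷ h i) p s

Σ₁-cong : {ρ σ : Vector (Fin (length u)) n} → IsΣ₁ φ → ρ ≗ σ → Sat u σ φ → Sat u ρ φ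
Σ₁-cong {u = u} p eq = Σ₁-extend ⊆-refl (λ i → trans (eq i) (sym (position-refl u _))) p

-- One step of gathering the values of an assignment into a subword: `i` costs at most one letter,
-- and `τ` says where the old positions went.
insertPosition : (e : x ⊆ u) (i : Fin (length u)) →
  ∃[ y ] length y ≤ suc (length x) × Σ[ f ∈ y ⊆ u ] Σ[ j ∈ Fin (length y) ]
    Σ[ τ ∈ Vector (Fin (length y)) (length x) ] i ≡ position f j × Tracks f (position e) τ
insertPosition {x = x} (a ∷ʳ e)   zero    =
  a ∷ x , ℕ.≤-refl , refl ∷ e , zero , suc , refl , λ _ → refl
insertPosition         (a ∷ʳ e)   (suc i)
  with y , l , f , j , τ , eq , h ← insertPosition e i =
  y , l , a ∷ʳ f , j , τ , cong suc eq , λ l → cong suc (h l)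
insertPosition {x = x} (refl ∷ e) zero    =
  x , ℕ.n≤1+n _ , refl ∷ e , zero , id , refl , λ _ → refl
insertPosition         (refl ∷ e) (suc i)
  with y , l , f , j , τ , eq , h ← insertPosition e i =
  _ ∷ y , s≤s l , refl ∷ f , suc j , (λ { zero → zero ; (suc l) → suc (τ l) }) , cong suc eq ,
  λ { zero → refl ; (suc l) → cong suc (h l) }

collectPositions : (ρ : Vector (Fin (length u)) n) →
  ∃[ x ] length x ≤ n × ∃₂ λ (e : x ⊆ u) σ → Tracks e ρ σ
collectPositions {n = zero}  ρ = [] , z≤n , minimum _ , (λ ()) , λ ()
collectPositions {n = suc n} ρ
  with x , l , e , σ , h ← collectPositions (Vector.tail ρ)
  with y , l′ , f , j , τ , eq , h′ ← insertPosition e (ρ zero) =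
  y , ℕ.≤-trans l′ (s≤s l) , f , (j Vector.∷ τ ∘ σ) ,
  λ { zero → eq ; (suc i) → trans (h i) (h′ (σ i)) }

Σ₁-rank : {φ : Formula k n} → IsΣ₁ φ → ℕ
Σ₁-rank {n = n} (matrix _) = n
Σ₁-rank         (exists p) = Σ₁-rank p

-- The witnesses of the quantifiers and the values of the free variables span a subword, and the
-- matrix only speaks about these positions.
Σ₁-restrict : {ρ : Vector (Fin (length u)) n} {φ : Formula k n} (p : IsΣ₁ φ) → Sat u ρ φ →
  ∃[ x ] length x ≤ Σ₁-rank p × ∃₂ λ (e : x ⊆ u) σ → Tracks e ρ σ × Sat x σ φ
Σ₁-restrict (matrix p) s with x , l , e , σ , h ← collectPositions _ =
  x , l , e , σ , h , qf-restrict e h p s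
Σ₁-restrict {n = n} (exists p) (i , s) with x , l , e , σ , h , t ← Σ₁-restrict p s =
  x , l , e , Vector.tail σ , h ∘ suc , σ zero ,
  Σ₁-cong p (λ { zero → refl ; (suc _) → refl }) t

infix 4 _≼[_]_ _∼[_]_

_≼[_]_ : Word k → ℕ → Word k → Set
u ≼[ m ] v = ∀ x → length x ≤ m → x ⊆ u → x ⊆ v

-- Simon's congruence.
_∼[_]_ : Word k → ℕ → Word k → Set
u ∼[ m ] v = u ≼[ m ] v × v ≼[ m ] u

∼-weaken : ∀ {l m} → l ≤ m → u ∼[ m ] v → u ∼[ l ] v
∼-weaken l≤m (f , g) = (λ x l → f x (ℕ.≤-trans l l≤m)) , λ x l → g x (ℕ.≤-trans l l≤m)

Invariant : ℕ → Language k → Set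
Invariant m K = ∀ u v → u ∼[ m ] v → K u → K v

invariant-weaken : ∀ {l m} {K : Language k} → l ≤ m → Invariant l K → Invariant m K
invariant-weaken l≤m i u v e = i u v (∼-weaken l≤m e)

Σ₁-invariant : {φ : Sentence k} (p : IsΣ₁ φ) → Invariant (Σ₁-rank p) (Defined φ)
Σ₁-invariant p u v (f , _) s with x , l , e , σ , h , t ← Σ₁-restrict p s =
  Σ₁-extend (f x l e) (λ ()) p t

BΣ₁-invariant : {φ : Sentence k} → IsBΣ₁ φ → ∃[ m ] Invariant m (Defined φ)
BΣ₁-invariant (Σ₁-base p)  = Σ₁-rank p , Σ₁-invariant p
BΣ₁-invariant (¬-bool p)   with m , i ← BΣ₁-invariant p =
  m , λ u v (f , g) s → s ∘ i v u (g , f)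
BΣ₁-invariant (∧-bool p q) with l , i ← BΣ₁-invariant p with m , j ← BΣ₁-invariant q =
  l ⊔ m , λ u v e (s , t) →
    invariant-weaken (ℕ.m≤m⊔n l m) i u v e s , invariant-weaken (ℕ.m≤n⊔m l m) j u v e t
BΣ₁-invariant (∨-bool p q) with l , i ← BΣ₁-invariant p with m , j ← BΣ₁-invariant q =
  l ⊔ m , λ u v e → Sum.map
    (invariant-weaken (ℕ.m≤m⊔n l m) i u v e) (invariant-weaken (ℕ.m≤n⊔m l m) j u v e)

-- A short subword of `u` lies in the ideal of `T`, hence embeds in the unfolding, hence in `v`.
∈⟨⟩⇒≼ : u ∈⟨ N ⟩ T → v ∈⟨ N ⟩ T → u ≼[ N ] v
∈⟨⟩⇒≼ {T = T} (d , _) (_ , e) x l f = ⊆-trans (short-⊆-unfold T l (∈↓-down f d)) e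

-- Sentences defining the words of a template.

∃ⁿ : ∀ n → Formula k n → Sentence k
∃ⁿ zero    φ = φ
∃ⁿ (suc n) φ = ∃ⁿ n (∃′ φ)

∃ⁿ-Σ₁ : ∀ n {φ : Formula k n} → IsΣ₁ φ → IsΣ₁ (∃ⁿ n φ)
∃ⁿ-Σ₁ zero    p = p
∃ⁿ-Σ₁ (suc n) p = ∃ⁿ-Σ₁ n (exists p)

∃ⁿ-elim : ∀ n {φ : Formula k n} → Defined (∃ⁿ n φ) w → ∃[ ρ ] Sat w ρ φ
∃ⁿ-elim zero    s = _ , s
∃ⁿ-elim (suc n) s with ρ , i , t ← ∃ⁿ-elim n s = _ , t

∃ⁿ-intro : ∀ n {φ : Formula k n} {ρ} → IsΣ₁ φ → Sat w ρ φ → Defined (∃ⁿ n φ) w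
∃ⁿ-intro zero            p s = Σ₁-cong p (λ ()) s
∃ⁿ-intro (suc n) {ρ = ρ} p s = ∃ⁿ-intro n {ρ = Vector.tail ρ} (exists p)
  (ρ zero , Σ₁-cong p (λ { zero → refl ; (suc _) → refl }) s)

-- Comparing neighbouring positions suffices, by transitivity. The renaming `f` lets the recursion
-- keep the assignment.
occurrences : (x : Word k) → (Fin (length x) → Fin n) → Formula k n
occurrences []          f = ⊤′
occurrences (a ∷ [])    f = P a (f zero)
occurrences (a ∷ b ∷ x) f =
  P a (f zero) ∧′ (f zero <′ f (suc zero)) ∧′ occurrences (b ∷ x) (f ∘ suc)

occurrences-qf : (x : Word k) (f : Fin (length x) → Fin n) → QuantifierFree (occurrences x f)
occurrences-qf []          f = ⊤-qf
occurrences-qf (a ∷ [])    f = P-qf _ _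
occurrences-qf (a ∷ b ∷ x) f =
  ∧-qf (P-qf _ _) (∧-qf (<-qf _ _) (occurrences-qf (b ∷ x) (f ∘ suc)))

∷-drop : ∀ (w : Word k) i → lookup w i ≡ a → x ⊆ drop (suc (toℕ i)) w → a ∷ x ⊆ drop (toℕ i) w
∷-drop (_ ∷ w) zero    eq e = sym eq ∷ e
∷-drop (_ ∷ w) (suc i) eq e = ∷-drop w i eq e

module _ {w : Word k} {ρ : Vector (Fin (length w)) n} where

  occurrences-intro : ∀ x f → (∀ i → lookup w (ρ (f i)) ≡ lookup x i) →
                      (∀ {i j} → i < j → ρ (f i) < ρ (f j)) → Sat w ρ (occurrences x f)
  occurrences-intro []          f h m = tt
  occurrences-intro (a ∷ [])    f h m = h zero
  occurrences-intro (a ∷ b ∷ x) f h m =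
    h zero , m (s≤s z≤n) , occurrences-intro (b ∷ x) (f ∘ suc) (h ∘ suc) (m ∘ s<s)

  -- Embedding into a suffix of `w` strengthens the induction: the rest of the word is found
  -- strictly behind the first position.
  occurrences-elim : ∀ a x f → Sat w ρ (occurrences (a ∷ x) f) →
                     a ∷ x ⊆ drop (toℕ (ρ (f zero))) w
  occurrences-elim a []      f eq            = ∷-drop w (ρ (f zero)) eq (minimum _)
  occurrences-elim a (b ∷ x) f (eq , lt , s) = ∷-drop w (ρ (f zero)) eq
    (⊆-trans (occurrences-elim b x (f ∘ suc) s) (drop⁺ lt ⊆-refl))

subword : Word k → Sentence k
subword x = ∃ⁿ (length x) (occurrences x id)

subword-Σ₁ : (x : Word k) → IsΣ₁ (subword x)
subword-Σ₁ x = ∃ⁿ-Σ₁ (length x) (matrix (occurrences-qf x id))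

subword-intro : x ⊆ w → Defined (subword x) w
subword-intro {x = x} e = ∃ⁿ-intro (length x) {ρ = position e} (matrix (occurrences-qf x id))
  (occurrences-intro x id (lookup-position e) (position-mono e))

subword-elim : ∀ x → Defined (subword x) w → x ⊆ w
subword-elim         []      _ = minimum _
subword-elim {w = w} (a ∷ x) s with ρ , t ← ∃ⁿ-elim (length (a ∷ x)) s =
  ⊆-trans (occurrences-elim a x id t) (drop-⊆ (toℕ (ρ zero)) w)

avoids : List (Word k) → Sentence k
avoids []       = ⊤′
avoids (x ∷ xs) = ¬′ subword x ∧′ avoids xs

avoids-BΣ₁ : (xs : List (Word k)) → IsBΣ₁ (avoids xs)
avoids-BΣ₁ []       = Σ₁-base (matrix ⊤-qf)
avoids-BΣ₁ (x ∷ xs) = ∧-bool (¬-bool (Σ₁-base (subword-Σ₁ x))) (avoids-BΣ₁ xs)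

avoids-intro : ∀ xs → All (λ x → ¬ (x ⊆ w)) xs → Defined (avoids xs) w
avoids-intro []       []         = tt
avoids-intro (x ∷ xs) (¬e ∷ ¬es) = ¬e ∘ subword-elim x , avoids-intro xs ¬es

avoids-elim : ∀ xs → Defined (avoids xs) w → All (λ x → ¬ (x ⊆ w)) xs
avoids-elim []       _        = []
avoids-elim (x ∷ xs) (¬s , s) = ¬s ∘ subword-intro ∷ avoids-elim xs s

obstructions : Template k → List (Word k)
obstructions T = filter (λ x → ¬? (x ∈↓? T)) (obstructionCandidates T)

-- The ideal is closed under subwords, and `obstructed` shows that finitely many forbidden subwords
-- cut it out; containing the unfolding is one more subword condition.
∈⟨⟩-BΣ₁ : ∀ N (T : Template k) → BΣ₁ k (_∈⟨ N ⟩ T)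
∈⟨⟩-BΣ₁ N T =
  subword (unfold N T) ∧′ avoids (obstructions T) ,
  ∧-bool (Σ₁-base (subword-Σ₁ (unfold N T))) (avoids-BΣ₁ (obstructions T)) ,
  (λ (d , e) → subword-intro e , avoids-intro (obstructions T)
    (All.map (λ ¬x e → ¬x (∈↓-down e d)) (All.all-filter _ (obstructionCandidates T)))) ,
  λ {w} (s , s′) →
    decidable-stable (w ∈↓? T) (λ ¬d →
      let x , m , e , ¬x = obstructed T w ¬d
      in  All.lookup (avoids-elim (obstructions T) s′) (∈-filter⁺ _ m ¬x) e) ,
    subword-elim (unfold N T) s

-- The covering problem

module CayleyAutomaton {k : ℕ} (ℳ : MonoidRecognizer k) where
  open MonoidRecognizer ℳ
  open IsMonoid isMonoid using (assoc; identityˡ; identityʳ)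
  open MonoidMorphisms.IsMonoidHomomorphism α-homo using (homo; ε-homo)

  -- The right Cayley graph: the state reached from `ε` is the value of the word read so far.
  automatonOf : NFA k
  automatonOf = record
    { states  = size
    ; initial = ⁅ ε ⁆
    ; final   = accepting
    ; δ       = λ q a → ⁅ q ∙ α [ a ] ⁆
    }

  open NFA automatonOf

  ∙-α-∷ : ∀ q a w → (q ∙ α [ a ]) ∙ α w ≡ q ∙ α (a ∷ w)
  ∙-α-∷ q a w = trans (assoc q _ _) (cong (q ∙_) (sym (homo [ a ] w)))

  ∙-α-[] : ∀ q → q ∙ α [] ≡ q
  ∙-α-[] q = trans (cong (q ∙_) ε-homo) (identityʳ q)

  acceptsFrom⇒ : ∀ q w → AcceptsFrom q w → q ∙ α w ∈ˢ accepting
  acceptsFrom⇒ q []      f = subst (_∈ˢ accepting) (sym (∙-α-[] q)) f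
  acceptsFrom⇒ q (a ∷ w) (_ , e , x) with refl ← x∈⁅y⁆⇒x≡y _ e =
    subst (_∈ˢ accepting) (∙-α-∷ q a w) (acceptsFrom⇒ _ w x)

  ⇒acceptsFrom : ∀ q w → q ∙ α w ∈ˢ accepting → AcceptsFrom q w
  ⇒acceptsFrom q []      m = subst (_∈ˢ accepting) (∙-α-[] q) m
  ⇒acceptsFrom q (a ∷ w) m =
    _ , x∈⁅x⁆ _ , ⇒acceptsFrom _ w (subst (_∈ˢ accepting) (sym (∙-α-∷ q a w)) m)

  recognized≐accepts : Recognized ≐ Accepts
  recognized≐accepts =
    (λ {w} m → ε , x∈⁅x⁆ ε , ⇒acceptsFrom ε w (subst (_∈ˢ accepting) (sym (identityˡ _)) m)) ,
    λ { {w} (q , i , x) → recognized w (x∈⁅y⁆⇒x≡y ε i) x }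
    where
    recognized : ∀ {q} w → q ≡ ε → AcceptsFrom q w → Recognized w
    recognized w refl x = subst (_∈ˢ accepting) (identityˡ _) (acceptsFrom⇒ ε w x)

toNFA : RegularInput k → NFA k
toNFA (automaton 𝒜) = 𝒜
toNFA (morphism ℳ)  = CayleyAutomaton.automatonOf ℳ

toNFA-correct : (I : RegularInput k) → ⟦ I ⟧ ≐ NFA.Accepts (toNFA I)
toNFA-correct (automaton 𝒜) = id , id
toNFA-correct (morphism ℳ)  = CayleyAutomaton.recognized≐accepts ℳ

stateCount : RegularInput k → ℕ
stateCount I = NFA.states (toNFA I)

HasPath : Template k → RegularInput k → Set
HasPath T I = Paths.AcceptingPath (toNFA I) T

hasPath? : (T : Template k) → Decidable (HasPath T)
hasPath? T I = Paths.acceptingPath? (toNFA I) T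

hasPath⇒word : ∀ N (I : RegularInput k) → HasPath T I → ∃[ w ] ⟦ I ⟧ w × w ∈⟨ N ⟩ T
hasPath⇒word N I (q , r , i , f , p) with w , x , y ← Paths.pump (toNFA I) N _ p =
  w , proj₂ (toNFA-correct I) (q , i , Paths.run⇒accepts (toNFA I) w y f) , exact⇒∈⟨⟩ x

-- Each block has two spare copies: one may be lost to the factor of a preceding block, the other is
-- the reserve in `exact`.
word⇒hasPath : ∀ (I : RegularInput k) → stateCount I ≤ N → Reduced T →
               ⟦ I ⟧ w → w ∈⟨ suc (suc N) ⟩ T → HasPath T I
word⇒hasPath {T = T} {w = w} I l r m (d , e)
  with q , i , x ← proj₁ (toNFA-correct I) m
  with s , f , y ← Paths.accepts⇒run (toNFA I) w x =
  q , s , i , f ,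
  Paths.exact⇒path (toNFA I) l (exact r d (⊆-trans (trimmed-⊆ T) e)) y

common-invariance : (𝐊 : List (Language k)) → All (BΣ₁ k) 𝐊 → ∃[ m ] All (Invariant m) 𝐊
common-invariance []       []       = 0 , []
common-invariance (K ∷ 𝐊) ((φ , p , f , g) ∷ ps)
  with l , i ← BΣ₁-invariant p with m , is ← common-invariance 𝐊 ps =
  l ⊔ m ,
  (λ u v e → g ∘ invariant-weaken (ℕ.m≤m⊔n l m) i u v e ∘ f) ∷
  All.map (invariant-weaken (ℕ.m≤n⊔m l m)) is

module _ (L : RegularInput k) (𝐋 : List (RegularInput k)) where

  -- Take `m` such that the whole cover is invariant under `_∼[ m ]_`. A set `K` that contains a
  -- word of `T` from `L` contains every word of `T` for `m`, so it meets every language in `𝐋`.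
  common-path⇒¬coverable : HasPath T L → All (HasPath T) 𝐋 → ¬ CoveringProblem (BΣ₁ k) (L , 𝐋)
  common-path⇒¬coverable p ps (𝐊 , (bs , cover) , sep)
    with m , is ← common-invariance 𝐊 bs
    with w , w∈L , x ← hasPath⇒word m L p
    with K , K∈ , w∈K ← find (cover w∈L)
    with L′ , L′∈ , empty ← find (All.lookup sep K∈)
    with I , I∈ , refl ← ∈-map⁻ ⟦_⟧ L′∈
    with v , v∈I , y ← hasPath⇒word m I (All.lookup ps I∈) =
    empty v (All.lookup is K∈ w v (∈⟨⟩⇒≼ x y , ∈⟨⟩⇒≼ y x) w∈K , v∈I)

  private
    bound : ℕ
    bound = max 0 (map stateCount (L ∷ 𝐋))

    stateCount-≤-bound : All (λ I → stateCount I ≤ bound) (L ∷ 𝐋)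
    stateCount-≤-bound = All.map⁻ (xs≤max 0 (map stateCount (L ∷ 𝐋)))

  Cover : Template k → Language k
  Cover T w = w ∈⟨ suc (suc bound) ⟩ T

  templates : List (Template k)
  templates = map (proj₁ ∘ reduce) (templatesOver (suc (suc bound)) k (allFin k))

  Blocked : Template k → Set
  Blocked T = Any (¬_ ∘ HasPath T) 𝐋

  blocked? : Decidable Blocked
  blocked? T = Any.any? (¬? ∘ hasPath? T) 𝐋

  templates-cover : ∀ w → ∃[ T ] T ∈ templates × Reduced T × Cover T w
  templates-cover w
    with T , T∈ , x ← templatesOver-complete {B = allFin k} (suc (suc bound)) k
           (ℕ.≤-reflexive (List.length-tabulate id)) (All.tabulate {xs = w} λ _ → ∈-allFin _)
    with r , T′⊑T ← proj₂ (reduce T) =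
    _ , ∈-map⁺ (proj₁ ∘ reduce) T∈ , r , ∈⟨⟩-mono T′⊑T x

  templates-reduced : All Reduced templates
  templates-reduced = All.map⁺ (All.tabulate λ {T} _ → proj₁ (proj₂ (reduce T)))

  -- Only the templates blocked by some member of `𝐋` are kept. The others have paths in all of `𝐋`,
  -- hence none in `L`, so no word of `L` needs them.
  no-common-path⇒coverable : ¬ Any (λ T → HasPath T L × All (HasPath T) 𝐋) templates →
                             CoveringProblem (BΣ₁ k) (L , 𝐋)
  no-common-path⇒coverable none =
    map Cover chosen ,
    (All.map⁺ (All.tabulate λ {T} _ → ∈⟨⟩-BΣ₁ (suc (suc bound)) T) , λ {w} → cover w) ,
    All.map⁺ (All.tabulate separates)
    where
    chosen : List (Template k)
    chosen = filter blocked? templates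
    cover : ∀ w → ⟦ L ⟧ w → Any (λ K → K w) (map Cover chosen)
    cover w w∈L with T , T∈ , r , x ← templates-cover w =
      Any.map⁺ (lose (∈-filter⁺ blocked? T∈ (All.¬All⇒Any¬ (hasPath? T) 𝐋 λ ps →
        none (lose T∈ (word⇒hasPath L (All.head stateCount-≤-bound) r w∈L x , ps)))) x)
    separates : ∀ {T} → T ∈ chosen → Any (λ L′ → ∀ w → ¬ (Cover T w × L′ w)) (map ⟦_⟧ 𝐋)
    separates T∈
      with T∈′ , b ← ∈-filter⁻ blocked? {xs = templates} T∈
      with I , I∈ , ¬p ← find b =
      Any.map⁺ (lose I∈ λ w (x , w∈I) →
        ¬p (word⇒hasPath I (All.lookup stateCount-≤-bound (there I∈))
             (All.lookup templates-reduced T∈′) w∈I x))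

corollary7p4 : ∀ (k : ℕ) → Decidable (CoveringProblem (BΣ₁ k))
corollary7p4 k (L , 𝐋)
  with Any.any? (λ T → hasPath? T L ×-dec All.all? (hasPath? T) 𝐋) (templates L 𝐋)
... | no none = yes (no-common-path⇒coverable L 𝐋 none)
... | yes found with T , _ , p , ps ← find found = no (common-path⇒¬coverable L 𝐋 p ps)
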